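{- Let $k\ge 2$ and $t$ be any constants. There exists no algorithm for agents with constant memory (i.e. no finite automaton $\mathcal A$, fixed independently of the torus) that solves the Black Hole Search (BHS) problem in all oriented tori containing exactly one black hole and $k$ scattered agents, where each agent has constant memory and carries $t$ unmovable tokens.
   Context: Network: an anonymous (nodes unlabeled), synchronous, oriented torus of size $n\times m$, $n,m\ge 3$: at each node the four incident edges are consistently marked North, East, South, West. Exactly one node is a black hole: it destroys every agent entering it, leaving no trace. Agents: $k\ge 2$ anonymous identical agents are scattered, i.e. they start at pairwise distinct nodes, none at the black hole. They follow the same deterministic algorithm, start at the same time in the same initial state, do not know $n$ or $m$, and act synchronously. Each initially carries $t$ identical tokens ($t$ constant) which can be placed at nodes. Tokens and agents at a node are visible only to agents at the same node; agents can interact only by means of tokens and when they meet at the same node. In each time unit an agent at a node may detect tokens/agents at the node, release or take tokens there, and stay or move to an adjacent node. A token is unmovable if, once released at a node, it can never be moved from that node. Formally an agent is a Moore automaton $\mathcal A=(S,S_0,\Sigma,\Lambda,\delta,\phi)$ with a finite state set $S$, initial state $S_0$, transition function $\delta:S\times\Sigma\to S$ and output function $\phi:S\to\Lambda$. Elements of $\Sigma$ are quadruples $(D,x,y,b)$: $D\in\{\text{North, South, East, West, none}\}$ is the direction through which the agent arrived at the node, $x$ the number of tokens at the node, $y$ the number of tokens carried by the agent, and $b\in\{\text{true},\text{false}\}$ tells whether at least one other agent is at the node. Elements of $\Lambda$ are quadruples $(P,s,X,M)$: $P\in\{\text{put},\text{pick}\}$ is an action on $s$ tokens, $X\in\{\text{North,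 South, East, West, none}\}$ is the edge marked as dangerous, and $M\in\{\text{North, South, East, West, none}\}$ is the move; the token action is performed before the marking, and the marking before the move. (For unmovable tokens, picking up is impossible.) A link marked dangerous is permanently disabled. Solving BHS: for every position of the black hole and every initial placement of the scattered agents, within finite time all links incident to the black hole, and only those links, are marked dangerous and at least one agent survives. An algorithm solves BHS in all oriented tori if this holds for all $n,m\ge 3$ (with enough nodes to place the agents) with the same automaton. -}

module Defs where

open import Data.Bool using (Bool; true; false; if_then_else_; _∨_)
open import Data.Fin using (Fin; toℕ)
import Data.Fin.Properties as Fin
open import Data.Maybe using (Maybe; just; nothing; Is-just; maybe′; _>>=_)
import Data.Maybe as Maybe
import Data.Maybe.Properties as Maybe
open import Data.Nat using (ℕ; zero; suc; _+_; _∸_; _⊓_; _≤_; NonZero)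
open import Data.Nat.DivMod using (_mod_)
open import Data.Product using (_×_; _,_; ∃-syntax)
import Data.Product.Properties as Product
open import Data.Vec.Functional using (foldr)
open import Function.Bundles using (_⇔_)
open import Function.Definitions using (Injective)
open import Relation.Binary.Definitions using (DecidableEquality)
open import Relation.Binary.PropositionalEquality using (_≡_; _≢_; refl)
open import Relation.Nullary using (yes; no; does)
open import Relation.Nullary.Decidable using (_×-dec_; ¬?)

data Direction : Set where
  north east south west : Direction

opposite : Direction → Direction
opposite north = south
opposite east  = west
opposite south = north
opposite west  = east

data TokenAction : Set where
  put pick : TokenAction

-- In Input and Output the direction "none" is rendered as nothing.
record Input : Set where
  constructor input
  field
    -- The port of the current node through which the agent has just entered
    -- it (an agent that moved north enters through south); nothing if the
    -- agent did not change node in the last time unit.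
    arrival      : Maybe Direction
    tokensHere   : ℕ
    tokensOwn    : ℕ
    someoneElse  : Bool

record Output : Set where
  constructor output
  field
    action : TokenAction
    amount : ℕ
    danger : Maybe Direction
    move   : Maybe Direction

-- Finiteness of the state set is what "constant memory" means.
record Automaton : Set where
  field
    size    : ℕ
  State : Set
  State = Fin size
  field
    initial : State
    δ       : State → Input → State
    φ       : State → Output

-- Number of tokens that an agent carrying c tokens actually puts down.  It
-- cannot put more than it has, and, tokens being unmovable, picking up is
-- impossible, so that an attempted pick has no effect.
released : Output → ℕ → ℕ
released (output put  s _ _) c = s ⊓ c
released (output pick _ _ _) _ = 0

module Torus (n m : ℕ) .{{_ : NonZero n}} .{{_ : NonZero m}} where

  Node : Set
  Node = Fin n × Fin m

  neighbour : Node → Direction → Node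
  neighbour (i , j) north = suc (toℕ i) mod n , j
  neighbour (i , j) south = (toℕ i + (n ∸ 1)) mod n , j
  neighbour (i , j) east  = i , suc (toℕ j) mod m
  neighbour (i , j) west  = i , (toℕ j + (m ∸ 1)) mod m

  data Axis : Set where
    northSouth eastWest : Axis

  -- (v , northSouth) is the undirected edge between v and its north
  -- neighbour, (v , eastWest) the one between v and its east neighbour.
  Link : Set
  Link = Node × Axis

  link : Node → Direction → Link
  link v north = v , northSouth
  link v east  = v , eastWest
  link v south = neighbour v south , northSouth
  link v west  = neighbour v west , eastWest

  _≟ᵃ_ : DecidableEquality Axis
  northSouth ≟ᵃ northSouth = yes refl
  northSouth ≟ᵃ eastWest   = no λ ()
  eastWest   ≟ᵃ northSouth = no λ ()
  eastWest   ≟ᵃ eastWest   = yes refl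

  _≟ⁿ_ : DecidableEquality Node
  _≟ⁿ_ = Product.≡-dec Fin._≟_ Fin._≟_

  _≟ˡ_ : DecidableEquality Link
  _≟ˡ_ = Product.≡-dec _≟ⁿ_ _≟ᵃ_

  module Execution (A : Automaton) (k t : ℕ) (blackHole : Node) where
    open Automaton A
    open Output

    record Agent : Set where
      constructor agent
      field
        position : Node
        state    : State
        carried  : ℕ
    open Agent

    -- agents i ≡ nothing means that agent i has been destroyed.
    record Config : Set where
      constructor config
      field
        agents : Fin k → Maybe Agent
        tokens : Node → ℕ
        marked : Link → Bool
    open Config

    start : (Fin k → Node) → Config
    start place = config (λ i → just (agent (place i) initial t))
                         (λ _ → 0)
                         (λ _ → false)

    releasedBy : Agent → ℕ
    releasedBy a = released (φ (state a)) (carried a)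

    releasedAt : Node → Maybe Agent → ℕ
    releasedAt v nothing  = 0
    releasedAt v (just a) = if does (position a ≟ⁿ v) then releasedBy a else 0

    marks : Agent → Maybe Link
    marks a = Maybe.map (link (position a)) (danger (φ (state a)))

    -- One time unit: all agents act on tokens, then all mark links, then all
    -- move; finally the survivors read their inputs and change state.  An agent
    -- trying to traverse a link that is disabled at that moment stays where it
    -- is.
    module Step (c : Config) where

      dropped : Node → ℕ
      dropped v = foldr _+_ 0 (λ i → releasedAt v (agents c i))

      newTokens : Node → ℕ
      newTokens v = tokens c v + dropped v

      newMarked : Link → Bool
      newMarked l = marked c l ∨
        does (Fin.any? λ i →
          Maybe.≡-dec _≟ˡ_ (agents c i >>= marks) (just l))

      -- New node and port of arrival, before the effect of the black hole.
      destination : Agent → Node × Maybe Direction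
      destination a = maybe′ go stay (move (φ (state a)))
        where
        stay : Node × Maybe Direction
        stay = position a , nothing
        go : Direction → Node × Maybe Direction
        go d = if newMarked (link (position a) d)
               then stay
               else (neighbour (position a) d , just (opposite d))

      survive : Node × Maybe Direction → Maybe (Node × Maybe Direction)
      survive (v , d) = if does (v ≟ⁿ blackHole) then nothing else just (v , d)

      arrivals : Fin k → Maybe (Node × Maybe Direction)
      arrivals i = agents c i >>= λ a → survive (destination a)

      newPosition : Fin k → Maybe Node
      newPosition i = Maybe.map (λ (v , _) → v) (arrivals i)

      otherAgentAt : Fin k → Node → Bool
      otherAgentAt i v = does (Fin.any? λ j →
        ¬? (j Fin.≟ i) ×-dec Maybe.≡-dec _≟ⁿ_ (newPosition j) (just v))

      newAgent : Fin k → Maybe Agent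
      newAgent i =
        agents c i >>= λ a →
        arrivals i >>= λ (v , d) →
        let y = carried a ∸ releasedBy a in
        just (agent v (δ (state a) (input d (newTokens v) y (otherAgentAt i v))) y)

      next : Config
      next = config newAgent newTokens newMarked

    run : (Fin k → Node) → ℕ → Config
    run place zero    = start place
    run place (suc τ) = Step.next (run place τ)

    Solved : Config → Set
    Solved c = (∀ l → marked c l ≡ true ⇔ (∃[ d ] l ≡ link blackHole d))
             × (∃[ i ] Is-just (agents c i))

-- Injectivity of the placement implies that the torus has enough nodes.
SolvesBHS : (k t : ℕ) → Automaton → Set
SolvesBHS k t A =
  ∀ (n m : ℕ) .{{_ : NonZero n}} .{{_ : NonZero m}} → 3 ≤ n → 3 ≤ m →
  let open Torus n m in
  ∀ (blackHole : Node) (place : Fin k → Node) →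
  Injective _≡_ _≡_ place → (∀ i → place i ≢ blackHole) →
  let open Execution A k t blackHole in
  ∃[ τ ] Solved (run place τ)

{-# OPTIONS --safe #-}
-- As long as nobody marks a link, meets a foreign token or another agent, or reaches the black
-- hole, all agents perform translated copies of one and the same walk; two of them never meet,
-- since at every moment both are displaced from distinct starts by the same offset.  A lone agent
-- drops tokens at no more than t nodes, and between two sightings of tokens it is an autonomous
-- finite automaton, which on the N × N torus starts repeating itself within O(N) steps; so the walk
-- visits only O(N) nodes.  Hence "some agent sees a token of another one"
-- and "some agent comes next to the black hole" each rule out only O(N) of the N² differences
-- of two chosen nodes, and for large N the starts and the black hole can be chosen greedily so
-- that neither happens.  Then the first link to be marked, if any, is not at the black hole.

module Submission where

open import Defs
open import Data.Nat hiding (_≟_)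
open import Data.Nat.Properties hiding (_≟_)
open import Algebra.Properties.CommutativeMonoid.Sum +-0-commutativeMonoid
  using (sum; sum-cong-≗; sum-remove; sum-replicate-zero; ∑-distrib-+)
open import Data.Bool using (true; false; if_then_else_; _∨_)
open import Data.Bool.Properties using (∨-zeroʳ)
open import Data.Fin using (Fin; zero; suc; toℕ; combine; remQuot; punchIn)
import Data.Fin as Fin using (_<_)
import Data.Fin.Properties as Fin
open import Data.List using
  (List; []; _∷_; _++_; length; lookup; map; tabulate; upTo; allFin; cartesianProductWith; cartesianProduct)
open import Data.List.Properties using (length-++; length-map; length-tabulate; length-applyUpTo)
open import Data.List.Membership.Propositional using (_∈_; _∉_)
open import Data.List.Membership.Propositional.Properties using
  (∈-++⁺ˡ; ∈-++⁺ʳ; ∈-cartesianProductWith⁺; ∈-cartesianProduct⁺; ∈-upTo⁺; ∈-allFin; ∈-tabulate⁺)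
import Data.List.Membership.DecPropositional as DecMembership
open import Data.List.Relation.Unary.Any using (here; there; index)
open import Data.List.Relation.Unary.Any.Properties using (lookup-index)
open import Data.Maybe using (Maybe; just; nothing; maybe′; _>>=_)
import Data.Maybe as Maybe using (map)
import Data.Maybe.Properties as Maybe
open import Data.Nat.DivMod using (_mod_; %-distribˡ-+; [m+kn]%n≡m%n; m<n⇒m%n≡m; m%n<n)
open import Data.Nat.Induction using (<-rec)
open import Data.Nat.Tactic.RingSolver using (solve-∀)
open import Data.Product using (_×_; _,_; ∃-syntax; proj₁; proj₂; uncurry)
open import Data.Sum using (_⊎_; inj₁; inj₂)
import Data.Vec.Functional as Vector
open import Function using (_∘_; mk⇔; module Equivalence)
open import Function.Definitions using (Injective)
open import Relation.Binary.Definitions using (tri<; tri≈; tri>)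
open import Relation.Binary.PropositionalEquality
open import Relation.Nullary using (¬_; yes; no; does; contradiction)
open import Relation.Nullary.Decidable using (dec-true; dec-false; does-⇔; ¬?; _×-dec_)

-- Offsets, and auxiliary facts on lists, sums and minima.

Offset : Set
Offset = ℕ × ℕ

infixl 6 _⊹_
infixl 7 _⋆_

_⊹_ : Offset → Offset → Offset
(x , y) ⊹ (x′ , y′) = x + x′ , y + y′

_⋆_ : ℕ → Offset → Offset
k ⋆ (x , y) = k * x , k * y

⊹-assoc : ∀ a b c → a ⊹ b ⊹ c ≡ a ⊹ (b ⊹ c)
⊹-assoc (x , y) (x′ , y′) (x″ , y″) = cong₂ _,_ (+-assoc x x′ x″) (+-assoc y y′ y″)

⊹-comm : ∀ a b → a ⊹ b ≡ b ⊹ a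
⊹-comm (x , y) (x′ , y′) = cong₂ _,_ (+-comm x x′) (+-comm y y′)

⊹-identityʳ : ∀ a → a ⊹ (0 , 0) ≡ a
⊹-identityʳ (x , y) = cong₂ _,_ (+-identityʳ x) (+-identityʳ y)

length-cartesianProductWith : ∀ {A B C : Set} (f : A → B → C) xs ys →
  length (cartesianProductWith f xs ys) ≡ length xs * length ys
length-cartesianProductWith f []       ys = refl
length-cartesianProductWith f (x ∷ xs) ys = trans (length-++ (map (f x) ys))
  (cong₂ _+_ (length-map (f x) ys) (length-cartesianProductWith f xs ys))

sum-only : ∀ {k} (f : Fin k → ℕ) i → (∀ j → j ≢ i → f j ≡ 0) → sum f ≡ f i
sum-only {suc k} f i others = begin
  sum f                                   ≡⟨ sum-remove {i = i} f ⟩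
  f i + sum (λ j → f (punchIn i j))   ≡⟨ cong (f i +_) (sum-cong-≗ (λ j → others _ (Fin.punchInᵢ≢i i j))) ⟩
  f i + sum {k} (λ _ → 0)                 ≡⟨ cong (f i +_) (sum-replicate-zero k) ⟩
  f i + 0                                 ≡⟨ +-identityʳ (f i) ⟩
  f i                                     ∎
  where open ≡-Reasoning

released-≤ : ∀ o c → released o c ≤ c
released-≤ (output put  s _ _) c = m⊓n≤n s c
released-≤ (output pick _ _ _) c = z≤n

-- Were there no minimum, well-founded induction on the value would show that no value is attained
-- at all. The double negation stays because no finite search certifies a minimum of an arbitrary
-- infinite sequence.
has-minimum : (f : ℕ → ℕ) → ¬ ¬ (∃[ σ ] ∀ τ → f σ ≤ f τ)
has-minimum f none = <-rec (λ n → ∀ σ → f σ ≢ n) none-at _ 0 refl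
  where
  none-at : ∀ n → (∀ {n′} → n′ < n → ∀ σ → f σ ≢ n′) → ∀ σ → f σ ≢ n
  none-at n smaller σ refl = none (σ , λ τ → ≮⇒≥ λ fτ<fσ → smaller fτ<fσ τ refl)

-- Orbits of an autonomous finite automaton and the displacement accumulated along them.

module Orbit {n : ℕ} (g : Fin n → Fin n) (w : Fin n → Offset) where

  iterate : ℕ → Fin n → Fin n
  iterate zero    s = s
  iterate (suc j) s = g (iterate j s)

  displacement : ℕ → Fin n → Offset
  displacement zero    s = 0 , 0
  displacement (suc j) s = displacement j s ⊹ w (iterate j s)

  iterate-+ : ∀ j i s → iterate (j + i) s ≡ iterate j (iterate i s)
  iterate-+ zero    i s = refl
  iterate-+ (suc j) i s = cong g (iterate-+ j i s)

  displacement-+ : ∀ j i s →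
    displacement (j + i) s ≡ displacement i s ⊹ displacement j (iterate i s)
  displacement-+ zero    i s = sym (⊹-identityʳ _)
  displacement-+ (suc j) i s = trans
    (cong₂ _⊹_ (displacement-+ j i s) (cong w (iterate-+ j i s)))
    (⊹-assoc (displacement i s) _ _)

  module _ (p : ℕ) {u : Fin n} (periodic : iterate p u ≡ u) where

    iterate-periods : ∀ k → iterate (k * p) u ≡ u
    iterate-periods zero    = refl
    iterate-periods (suc k) = trans (iterate-+ p (k * p) u)
      (trans (cong (iterate p) (iterate-periods k)) periodic)

    displacement-periods : ∀ k → displacement (k * p) u ≡ k ⋆ displacement p u
    displacement-periods zero    = refl
    displacement-periods (suc k) = trans (displacement-+ p (k * p) u)
      (trans (cong₂ _⊹_ (displacement-periods k) (cong (displacement p) (iterate-periods k)))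
             (⊹-comm (k ⋆ displacement p u) _))

-- Translations of the square torus.

-- Offsets are natural numbers: on the N-cycle with N = suc M, a step backwards is M steps
-- forwards, and M ⋆ a undoes a.
module Shift (M : ℕ) where

  N : ℕ
  N = suc M

  open Torus N N

  shift : Fin N → ℕ → Fin N
  shift i x = (toℕ i + x) mod N

  mod-cong : ∀ x y → x % N ≡ y % N → x mod N ≡ y mod N
  mod-cong x y eq = Fin.fromℕ<-cong _ _ eq (m%n<n x N) (m%n<n y N)

  toℕ-mod : ∀ x → toℕ (x mod N) ≡ x % N
  toℕ-mod x = Fin.toℕ-fromℕ< (m%n<n x N)

  %-absorbˡ : ∀ x y → (x % N + y) % N ≡ (x + y) % N
  %-absorbˡ x y = begin
    (x % N + y) % N             ≡⟨ %-distribˡ-+ (x % N) y N ⟩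
    (x % N % N + y % N) % N     ≡⟨ cong (λ z → (z + y % N) % N) (m<n⇒m%n≡m (m%n<n x N)) ⟩
    (x % N + y % N) % N         ≡⟨ %-distribˡ-+ x y N ⟨
    (x + y) % N                 ∎
    where open ≡-Reasoning

  mod-+-* : ∀ (i : Fin N) k → (toℕ i + k * N) mod N ≡ i
  mod-+-* i k = Fin.toℕ-injective (begin
    toℕ ((toℕ i + k * N) mod N)   ≡⟨ toℕ-mod (toℕ i + k * N) ⟩
    (toℕ i + k * N) % N           ≡⟨ [m+kn]%n≡m%n (toℕ i) k N ⟩
    toℕ i % N                     ≡⟨ m<n⇒m%n≡m (Fin.toℕ<n i) ⟩
    toℕ i                         ∎)
    where open ≡-Reasoning

  shift-+ : ∀ i x y → shift (shift i x) y ≡ shift i (x + y)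
  shift-+ i x y = mod-cong (toℕ (shift i x) + y) (toℕ i + (x + y)) (begin
    (toℕ (shift i x) + y) % N     ≡⟨ cong (λ z → (z + y) % N) (toℕ-mod (toℕ i + x)) ⟩
    ((toℕ i + x) % N + y) % N     ≡⟨ %-absorbˡ (toℕ i + x) y ⟩
    (toℕ i + x + y) % N           ≡⟨ cong (_% N) (+-assoc (toℕ i) x y) ⟩
    (toℕ i + (x + y)) % N         ∎)
    where open ≡-Reasoning

  shift-N* : ∀ i x → shift i (N * x) ≡ i
  shift-N* i x = trans (cong (λ z → (toℕ i + z) mod N) (*-comm N x)) (mod-+-* i x)

  shift-transitive : ∀ i j → shift i (M * toℕ i + toℕ j) ≡ j
  shift-transitive i j = trans (cong (_mod N) (rearrange (toℕ i) (toℕ j) M)) (mod-+-* j (toℕ i))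
    where
    rearrange : ∀ i j m → i + (m * i + j) ≡ j + i * suc m
    rearrange = solve-∀

  infixl 5 _⊞_

  _⊞_ : Node → Offset → Node
  (i , j) ⊞ (x , y) = shift i x , shift j y

  ⊞-⊹ : ∀ v a b → v ⊞ a ⊞ b ≡ v ⊞ (a ⊹ b)
  ⊞-⊹ (i , j) (x , y) (x′ , y′) = cong₂ _,_ (shift-+ i x x′) (shift-+ j y y′)

  ⊞-N⋆ : ∀ v a → v ⊞ N ⋆ a ≡ v
  ⊞-N⋆ (i , j) (x , y) = cong₂ _,_ (shift-N* i x) (shift-N* j y)

  ⊞-cancel : ∀ v a → v ⊞ a ⊞ M ⋆ a ≡ v
  ⊞-cancel v a = trans (⊞-⊹ v a (M ⋆ a)) (⊞-N⋆ v a)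

  ⊞-injective : ∀ {u v} a → u ⊞ a ≡ v ⊞ a → u ≡ v
  ⊞-injective {u} {v} a eq =
    trans (sym (⊞-cancel u a)) (trans (cong (_⊞ M ⋆ a) eq) (⊞-cancel v a))

  -- Turns a coincidence between two walks into an explicit difference `b - a` of their starts,
  -- which can then be forbidden.
  ⊞-solve : ∀ {u v a b} → u ⊞ a ≡ v ⊞ b → u ≡ v ⊞ (b ⊹ M ⋆ a)
  ⊞-solve {u} {v} {a} {b} eq =
    trans (sym (⊞-cancel u a)) (trans (cong (_⊞ M ⋆ a) eq) (⊞-⊹ v b (M ⋆ a)))

  ⊞-swap : ∀ v a b → v ⊞ a ⊞ b ≡ v ⊞ b ⊞ a
  ⊞-swap v a b = trans (⊞-⊹ v a b) (trans (cong (v ⊞_) (⊹-comm a b)) (sym (⊞-⊹ v b a)))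

  infix 4 _≈_

  _≈_ : Offset → Offset → Set
  a ≈ b = ∀ v → v ⊞ a ≡ v ⊞ b

  -- Translations commute and act transitively, so agreement at one node can be carried to every
  -- other.
  ⊞⇒≈ : ∀ v {a b} → v ⊞ a ≡ v ⊞ b → a ≈ b
  ⊞⇒≈ v {a} {b} eq u = begin
    u ⊞ a       ≡⟨ cong (_⊞ a) u≡ ⟨
    v ⊞ e ⊞ a   ≡⟨ ⊞-swap v e a ⟩
    v ⊞ a ⊞ e   ≡⟨ cong (_⊞ e) eq ⟩
    v ⊞ b ⊞ e   ≡⟨ ⊞-swap v b e ⟩
    v ⊞ e ⊞ b   ≡⟨ cong (_⊞ b) u≡ ⟩
    u ⊞ b       ∎
    where
    open ≡-Reasoning
    e : Offset
    e = M * toℕ (proj₁ v) + toℕ (proj₁ u) , M * toℕ (proj₂ v) + toℕ (proj₂ u)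
    u≡ : v ⊞ e ≡ u
    u≡ = cong₂ _,_ (shift-transitive (proj₁ v) (proj₁ u)) (shift-transitive (proj₂ v) (proj₂ u))

  ⊹-congˡ-≈ : ∀ {a b} c → a ≈ b → c ⊹ a ≈ c ⊹ b
  ⊹-congˡ-≈ {a} {b} c a≈b v = trans (sym (⊞-⊹ v c a)) (trans (a≈b (v ⊞ c)) (⊞-⊹ v c b))

  ⊹-congʳ-≈ : ∀ {a b} c → a ≈ b → a ⊹ c ≈ b ⊹ c
  ⊹-congʳ-≈ {a} {b} c a≈b v = trans (sym (⊞-⊹ v a c)) (trans (cong (_⊞ c) (a≈b v)) (⊞-⊹ v b c))

  unit : Direction → Offset
  unit north = 1 , 0
  unit south = M , 0
  unit east  = 0 , 1
  unit west  = 0 , M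

  shift-0 : ∀ i → shift i 0 ≡ i
  shift-0 i = mod-+-* i 0

  ⊞-0 : ∀ v → v ⊞ (0 , 0) ≡ v
  ⊞-0 (i , j) = cong₂ _,_ (shift-0 i) (shift-0 j)

  neighbour≡⊞ : ∀ v d → neighbour v d ≡ v ⊞ unit d
  neighbour≡⊞ (i , j) north = cong₂ _,_ (cong (_mod N) (+-comm 1 (toℕ i))) (sym (shift-0 j))
  neighbour≡⊞ (i , j) south = cong₂ _,_ refl (sym (shift-0 j))
  neighbour≡⊞ (i , j) east  = cong₂ _,_ (sym (shift-0 i)) (cong (_mod N) (+-comm 1 (toℕ j)))
  neighbour≡⊞ (i , j) west  = cong₂ _,_ (sym (shift-0 i)) refl

  neighbour-injective : ∀ {u v} d → neighbour u d ≡ neighbour v d → u ≡ v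
  neighbour-injective {u} {v} d eq = ⊞-injective (unit d)
    (trans (sym (neighbour≡⊞ u d)) (trans eq (neighbour≡⊞ v d)))

  neighbour-south-north : ∀ u → neighbour (neighbour u south) north ≡ u
  neighbour-south-north u = begin
    neighbour (neighbour u south) north   ≡⟨ neighbour≡⊞ (neighbour u south) north ⟩
    neighbour u south ⊞ unit north        ≡⟨ cong (_⊞ unit north) (neighbour≡⊞ u south) ⟩
    u ⊞ unit south ⊞ unit north           ≡⟨ ⊞-swap u (unit south) (unit north) ⟩
    u ⊞ unit north ⊞ unit south           ≡⟨ cong (u ⊞ unit north ⊞_) (cong₂ _,_ (*-identityʳ M) (*-zeroʳ M)) ⟨
    u ⊞ unit north ⊞ M ⋆ unit north       ≡⟨ ⊞-cancel u (unit north) ⟩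
    u                                     ∎
    where open ≡-Reasoning

  neighbour-west-east : ∀ u → neighbour (neighbour u west) east ≡ u
  neighbour-west-east u = begin
    neighbour (neighbour u west) east   ≡⟨ neighbour≡⊞ (neighbour u west) east ⟩
    neighbour u west ⊞ unit east        ≡⟨ cong (_⊞ unit east) (neighbour≡⊞ u west) ⟩
    u ⊞ unit west ⊞ unit east           ≡⟨ ⊞-swap u (unit west) (unit east) ⟩
    u ⊞ unit east ⊞ unit west           ≡⟨ cong (u ⊞ unit east ⊞_) (cong₂ _,_ (*-zeroʳ M) (*-identityʳ M)) ⟨
    u ⊞ unit east ⊞ M ⋆ unit east       ≡⟨ ⊞-cancel u (unit east) ⟩
    u                                   ∎
    where open ≡-Reasoning

  -- Used with `v` the black hole: only an agent at or next to it can mark one of its links.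
  shared-link : ∀ {u v} d e → link u d ≡ link v e → v ≡ u ⊎ ∃[ d′ ] v ≡ neighbour u d′
  shared-link north north eq = inj₁ (sym (cong proj₁ eq))
  shared-link {u} {v} north south eq = inj₂ (north ,
    trans (sym (neighbour-south-north v)) (cong (λ l → neighbour l north) (sym (cong proj₁ eq))))
  shared-link south north eq = inj₂ (south , sym (cong proj₁ eq))
  shared-link south south eq = inj₁ (neighbour-injective south (sym (cong proj₁ eq)))
  shared-link east  east  eq = inj₁ (sym (cong proj₁ eq))
  shared-link {u} {v} east west eq = inj₂ (east ,
    trans (sym (neighbour-west-east v)) (cong (λ l → neighbour l east) (sym (cong proj₁ eq))))
  shared-link west  east  eq = inj₂ (west , sym (cong proj₁ eq))
  shared-link west  west  eq = inj₁ (neighbour-injective west (sym (cong proj₁ eq)))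
  shared-link north east ()
  shared-link north west ()
  shared-link south east ()
  shared-link south west ()
  shared-link east north ()
  shared-link east south ()
  shared-link west north ()
  shared-link west south ()

  -- Greedy choice of nodes avoiding a list of differences.

  open DecMembership _≟ⁿ_ using (_∈?_)

  -- Pigeonhole: if `L` contained every node, two distinct nodes would occupy the same position in
  -- it.
  missing-node : (L : List Node) → length L < N * N → ∃[ v ] v ∉ L
  missing-node L short =
    let i , i∉ = Fin.¬∀⟶∃¬ (N * N) (λ i → node i ∈ L) (λ i → node i ∈? L) not-all in node i , i∉
    where
    node : Fin (N * N) → Node
    node = remQuot N
    node-injective : ∀ {i j} → node i ≡ node j → i ≡ j
    node-injective {i} {j} eq = trans (sym (Fin.combine-remQuot {N} N i))
      (trans (cong (uncurry combine) eq) (Fin.combine-remQuot {N} N j))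
    not-all : ¬ (∀ i → node i ∈ L)
    not-all all =
      let i , j , i<j , eq = Fin.pigeonhole short (λ i → index (all i))
      in Fin.<⇒≢ i<j (node-injective
           (trans (lookup-index (all i)) (trans (cong (lookup L) eq) (sym (lookup-index (all j))))))

  -- Each pair is constrained in one order only, which suits a greedy choice that puts every new
  -- node in front. Where both orders matter, the list `B` has to contain the differences for both.
  Spread : List Offset → (k : ℕ) → (Fin k → Node) → Set
  Spread B k p = ∀ {i j : Fin k} → i Fin.< j → ∀ {β} → β ∈ B → p i ≢ p j ⊞ β

  -- Every node already chosen rules out at most `length B` nodes for the next one, and the last of
  -- the `suc k` nodes has `k` predecessors.
  spread-∃ : ∀ B k → k * length B < N * N → ∃[ p ] Spread B (suc k) p
  spread-∃ B zero    _    = (λ _ → zero , zero) , λ { {zero} {zero} () ; {zero} {suc ()} }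
  spread-∃ B (suc k) room = fresh Vector.∷ p , spread
    where
    smaller : ∃[ p ] Spread B (suc k) p
    smaller = spread-∃ B k (≤-<-trans (m≤n+m _ (length B)) room)
    p : Fin (suc k) → Node
    p = proj₁ smaller
    avoided : List Node
    avoided = cartesianProductWith _⊞_ (tabulate p) B
    length-avoided : length avoided ≡ suc k * length B
    length-avoided = trans (length-cartesianProductWith _⊞_ (tabulate p) B)
      (cong (_* length B) (length-tabulate p))
    unavoided : ∃[ v ] v ∉ avoided
    unavoided = missing-node avoided (subst (_< N * N) (sym length-avoided) room)
    fresh : Node
    fresh = proj₁ unavoided
    spread : Spread B (suc (suc k)) (fresh Vector.∷ p)
    spread {zero}  {suc j} _         β∈B eq = proj₂ unavoided
      (subst (_∈ avoided) (sym eq) (∈-cartesianProductWith⁺ _⊞_ (∈-tabulate⁺ {f = p} j) β∈B))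
    spread {suc i} {suc j} (s≤s i<j) β∈B eq = proj₂ smaller i<j β∈B eq

  -- An autonomous walk reaches only linearly many displacements modulo N.

  module _ {n : ℕ} (g : Fin n → Fin n) (w : Fin n → Offset) where
    open Orbit g w

    -- A state recurs after p ≤ n steps, and N periods of length p bring the walk back to the
    -- same node in the same state, so N * p steps can be cut out.
    displacement-bounded : ∀ s j → ∃[ j′ ] j′ < n * suc N × displacement j′ s ≈ displacement j s
    displacement-bounded s = <-rec _ reduce
      where
      L = n * suc N
      reduce : ∀ j → (∀ {i} → i < j → ∃[ j′ ] j′ < L × displacement j′ s ≈ displacement i s) →
        ∃[ j′ ] j′ < L × displacement j′ s ≈ displacement j s
      reduce j rec with j <? L
      ... | yes j<L = j , j<L , λ v → refl
      ... | no  j≮L with i , i′ , i<i′ , eq ← Fin.pigeonhole (n<1+n n) (λ i → iterate (toℕ i) s) =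
        let j′ , j′<L , j′≈ = rec (subst (q + toℕ i <_) j≡ (+-monoʳ-< q (+-monoˡ-< (toℕ i) 0<Np))) in
        j′ , j′<L , λ v → trans (j′≈ v) (shortcut v)
        where
        p q : ℕ
        p = toℕ i′ ∸ toℕ i
        q = j ∸ (N * p + toℕ i)
        u : Fin n
        u = iterate (toℕ i) s
        0<Np : 0 < N * p
        0<Np = ≤-trans (m<n⇒0<n∸m i<i′) (m≤m+n p (M * p))
        i′≤n : toℕ i′ ≤ n
        i′≤n = s≤s⁻¹ (Fin.toℕ<n i′)
        -- The origin of the bound `n * suc N`: a preperiod of at most `n` steps followed by `N`
        -- periods of at most `n` steps each.
        Np+i≤j : N * p + toℕ i ≤ j
        Np+i≤j = begin
          N * p + toℕ i  ≤⟨ +-mono-≤ (*-monoʳ-≤ N p≤n) (≤-trans (<⇒≤ i<i′) i′≤n) ⟩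
          N * n + n      ≡⟨ rearrange M n ⟩
          n * suc N      ≤⟨ ≮⇒≥ j≮L ⟩
          j              ∎
          where
          open ≤-Reasoning
          p≤n : p ≤ n
          p≤n = ≤-trans (m∸n≤m (toℕ i′) (toℕ i)) i′≤n
          rearrange : ∀ m n → suc m * n + n ≡ n * suc (suc m)
          rearrange = solve-∀
        j≡ : q + (N * p + toℕ i) ≡ j
        j≡ = m∸n+n≡m Np+i≤j
        periodic : iterate p u ≡ u
        periodic = trans (sym (iterate-+ p (toℕ i) s))
          (trans (cong (λ z → iterate z s) (m∸n+n≡m (<⇒≤ i<i′))) (sym eq))
        d₀ : Offset
        d₀ = displacement (toℕ i) s
        displacement-j : displacement j s ≡ d₀ ⊹ (N ⋆ displacement p u ⊹ displacement q u)
        displacement-j = begin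
          displacement j s
            ≡⟨ cong (λ z → displacement z s) j≡ ⟨
          displacement (q + (N * p + toℕ i)) s
            ≡⟨ cong (λ z → displacement z s) (+-assoc q (N * p) (toℕ i)) ⟨
          displacement (q + N * p + toℕ i) s
            ≡⟨ displacement-+ (q + N * p) (toℕ i) s ⟩
          d₀ ⊹ displacement (q + N * p) u
            ≡⟨ cong (d₀ ⊹_) (displacement-+ q (N * p) u) ⟩
          d₀ ⊹ (displacement (N * p) u ⊹ displacement q (iterate (N * p) u))
            ≡⟨ cong (d₀ ⊹_) (cong₂ _⊹_ (displacement-periods p periodic N)
                 (cong (displacement q) (iterate-periods p periodic N))) ⟩
          d₀ ⊹ (N ⋆ displacement p u ⊹ displacement q u) ∎
          where open ≡-Reasoning
        N⋆-absorb : ∀ a b → b ≈ N ⋆ a ⊹ b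
        N⋆-absorb a b v = trans (sym (cong (_⊞ b) (⊞-N⋆ v a))) (⊞-⊹ v (N ⋆ a) b)
        shortcut : displacement (q + toℕ i) s ≈ displacement j s
        shortcut v = begin
          v ⊞ displacement (q + toℕ i) s
            ≡⟨ cong (v ⊞_) (displacement-+ q (toℕ i) s) ⟩
          v ⊞ (d₀ ⊹ displacement q u)
            ≡⟨ ⊹-congˡ-≈ d₀ (N⋆-absorb (displacement p u) (displacement q u)) v ⟩
          v ⊞ (d₀ ⊹ (N ⋆ displacement p u ⊹ displacement q u))
            ≡⟨ cong (v ⊞_) displacement-j ⟨
          v ⊞ displacement j s ∎
          where open ≡-Reasoning

-- The walk of a lone agent and its drops.

module Solo (A : Automaton) (t M : ℕ) where
  open Automaton A
  open Output
  open Shift M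
  open Torus N N

  -- This port and the step `pace` depend on the state alone, since the lone walk is followed only
  -- while no link is disabled.
  arrivalPort : State → Maybe Direction
  arrivalPort s = Maybe.map opposite (move (φ s))

  pace : State → Offset
  pace s = maybe′ unit (0 , 0) (move (φ s))

  History : Set
  History = List (Offset × ℕ)

  record Walker : Set where
    constructor walker
    field
      offset  : Offset
      state   : State
      carried : ℕ
      history : History
  open Walker public

  origin : Node
  origin = zero , zero

  -- Tokens at u after a walk from v; a history lists each offset with the number of tokens
  -- released there, which may be 0.
  count : Node → History → Node → ℕ
  count v []            u = 0
  count v ((a , r) ∷ h) u = (if does ((v ⊞ a) ≟ⁿ u) then r else 0) + count v h u

  -- Whether two offsets lead to the same node does not depend on the start (`⊞⇒≈`). Hence an agent
  -- sees its own tokens exactly as the walker at `origin` does.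
  count-translate : ∀ u v h b → count u h (u ⊞ b) ≡ count v h (v ⊞ b)
  count-translate u v []            b = refl
  count-translate u v ((a , r) ∷ h) b = cong₂ _+_
    (cong (if_then r else 0)
      (does-⇔ (mk⇔ (λ eq → ⊞⇒≈ u eq v) (λ eq → ⊞⇒≈ v eq u))
        ((u ⊞ a) ≟ⁿ (u ⊞ b)) ((v ⊞ a) ≟ⁿ (v ⊞ b))))
    (count-translate u v h b)

  -- Entries without released tokens are skipped, so that the list cannot outgrow the initial supply
  -- `t`.
  drops : History → List Offset
  drops []                = []
  drops ((a , zero)  ∷ h) = drops h
  drops ((a , suc _) ∷ h) = a ∷ drops h

  drops-∷ : ∀ a r h {z} → z ∈ drops h → z ∈ drops ((a , r) ∷ h)
  drops-∷ a zero    h z∈ = z∈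
  drops-∷ a (suc r) h z∈ = there z∈

  tokens-at : ∀ v h u → count v h u ≡ 0 ⊎ ∃[ z ] z ∈ drops h × v ⊞ z ≡ u
  tokens-at v []                u = inj₁ refl
  tokens-at v ((a , r) ∷ h) u with tokens-at v h u
  ... | inj₂ (z , z∈ , eq) = inj₂ (z , drops-∷ a r h z∈ , eq)
  tokens-at v ((a , zero)  ∷ h) u | inj₁ none with (v ⊞ a) ≟ⁿ u
  ... | yes _ = inj₁ none
  ... | no _  = inj₁ none
  tokens-at v ((a , suc r) ∷ h) u | inj₁ none with (v ⊞ a) ≟ⁿ u
  ... | yes eq = inj₂ (a , here refl , eq)
  ... | no _   = inj₁ none

  dropped : Walker → ℕ
  dropped w = released (φ (state w)) (carried w)

  dropped≤carried : ∀ w → dropped w ≤ carried w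
  dropped≤carried w = released-≤ (φ (state w)) (carried w)

  advance : Walker → Walker
  advance w = walker a′ (δ (state w) seen) c′ h′
    where
    a′ = offset w ⊹ pace (state w)
    h′ = (offset w , dropped w) ∷ history w
    c′ = carried w ∸ dropped w
    -- The input is read after the drop and the move, hence `h′`, `a′` and `c′`; `false` says that
    -- nobody else is there.
    seen = input (arrivalPort (state w)) (count origin h′ (origin ⊞ a′)) c′ false

  walk : ℕ → Walker
  walk zero    = walker (0 , 0) initial t []
  walk (suc τ) = advance (walk τ)

  -- Each new entry of `drops` costs at least one carried token, so the sum never increases.
  drops-bounded : ∀ τ → length (drops (history (walk τ))) + carried (walk τ) ≤ t
  drops-bounded zero    = ≤-refl
  drops-bounded (suc τ) = ≤-trans (step (dropped w) (dropped≤carried w)) (drops-bounded τ)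
    where
    w = walk τ
    c = carried w
    h = history w
    step : ∀ r → r ≤ c → length (drops ((offset w , r) ∷ h)) + (c ∸ r) ≤ length (drops h) + c
    step zero    _   = ≤-refl
    step (suc r) r<c = begin
      suc (length (drops h) + (c ∸ suc r))   ≡⟨ +-suc (length (drops h)) (c ∸ suc r) ⟨
      length (drops h) + suc (c ∸ suc r)     ≤⟨ +-monoʳ-≤ (length (drops h)) (∸-monoʳ-< (s≤s z≤n) r<c) ⟩
      length (drops h) + c                   ∎
      where open ≤-Reasoning

  drops-grow : ∀ d τ {z} → z ∈ drops (history (walk τ)) → z ∈ drops (history (walk (d + τ)))
  drops-grow zero    τ z∈ = z∈
  drops-grow (suc d) τ z∈ = drops-∷ (offset w) (dropped w) (history w) (drops-grow d τ z∈)
    where w = walk (d + τ)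

  carried-antitone : ∀ d τ → carried (walk (d + τ)) ≤ carried (walk τ)
  carried-antitone zero    τ = ≤-refl
  carried-antitone (suc d) τ = ≤-trans (m∸n≤m (carried w) (dropped w)) (carried-antitone d τ)
    where w = walk (d + τ)

  -- Once the number of carried tokens is minimal, another drop would push it below the minimum.
  drops-final : ∀ σ → (∀ τ → carried (walk σ) ≤ carried (walk τ)) →
    ∀ d → drops (history (walk (d + σ))) ≡ drops (history (walk σ))
  drops-final σ least zero    = refl
  drops-final σ least (suc d) = trans
    (step (dropped w) (dropped≤carried w) (≤-trans (carried-antitone d σ) (least (suc d + σ))))
    (drops-final σ least d)
    where
    w = walk (d + σ)
    c = carried w
    h = history w
    step : ∀ r → r ≤ c → c ≤ c ∸ r → drops ((offset w , r) ∷ h) ≡ drops h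
    step zero    _   _    = refl
    step (suc r) r<c kept = contradiction kept (<⇒≱ (∸-monoʳ-< (s≤s z≤n) r<c))

  AllDrops : List Offset → Set
  AllDrops T = ∀ τ {z} → z ∈ drops (history (walk τ)) → z ∈ T

  -- Only classically, since one cannot tell whether the walk will ever drop another token.
  finitely-many-drops : ¬ ¬ (∃[ T ] length T ≤ t × AllDrops T)
  finitely-many-drops none = has-minimum (carried ∘ walk) λ (σ , least) →
    none (drops (history (walk σ)) , ≤-trans (m≤m+n _ _) (drops-bounded σ) , all σ least)
    where
    all : ∀ σ → (∀ τ → carried (walk σ) ≤ carried (walk τ)) → AllDrops (drops (history (walk σ)))
    all σ least τ z∈ with ≤-total τ σ
    ... | inj₁ τ≤σ = subst (λ ρ → _ ∈ drops (history (walk ρ))) (m∸n+n≡m τ≤σ) (drops-grow (σ ∸ τ) τ z∈)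
    ... | inj₂ σ≤τ = subst (_ ∈_) (drops-final σ least (τ ∸ σ))
      (subst (λ ρ → _ ∈ drops (history (walk ρ))) (sym (m∸n+n≡m σ≤τ)) z∈)

  -- Covering the walk by token-free stretches.

  freeStep : ℕ → State → State
  freeStep c s = δ s (input (arrivalPort s) 0 c false)

  module Free (c : ℕ) = Orbit (freeStep c) pace

  -- By `displacement-bounded`, durations below `size * suc N` suffice up to `≈`; this keeps the
  -- list linear in `N`.
  freeOffsets : List Offset
  freeOffsets = cartesianProductWith (λ (c , s) j → Free.displacement c j s)
    (cartesianProduct (upTo (suc t)) (allFin size)) (upTo (size * suc N))

  visitable : List Offset → List Offset
  visitable T = cartesianProductWith _⊹_ ((0 , 0) ∷ T) freeOffsets

  length-freeOffsets : length freeOffsets ≡ suc t * size * (size * suc N)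
  length-freeOffsets = trans
    (length-cartesianProductWith _ (cartesianProduct (upTo (suc t)) (allFin size)) (upTo (size * suc N)))
    (cong₂ _*_
      (trans (length-cartesianProductWith _,_ (upTo (suc t)) (allFin size))
        (cong₂ _*_ (length-applyUpTo (λ i → i) (suc t)) (length-tabulate {n = size} _)))
      (length-applyUpTo (λ i → i) (size * suc N)))

  length-visitable : ∀ T → length T ≤ t →
    length (visitable T) ≤ suc t * (suc t * size * (size * suc N))
  length-visitable T short = begin
    length (visitable T)                          ≡⟨ length-cartesianProductWith _⊹_ ((0 , 0) ∷ T) freeOffsets ⟩
    suc (length T) * length freeOffsets           ≡⟨ cong (suc (length T) *_) length-freeOffsets ⟩
    suc (length T) * (suc t * size * (size * suc N))   ≤⟨ *-monoˡ-≤ _ (s≤s short) ⟩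
    suc t * (suc t * size * (size * suc N))       ∎
    where open ≤-Reasoning

  module _ {T : List Offset} (T-all : AllDrops T) where

    -- The base is the start, or the node where tokens were last seen or dropped; from there on
    -- the walk has been free.
    record Covered (w : Walker) : Set where
      constructor covered
      field
        {base}     : Offset
        base∈      : base ∈ (0 , 0) ∷ T
        baseState  : State
        duration   : ℕ
        offset≈    : offset w ≈ base ⊹ Free.displacement (carried w) duration baseState
        state≡     : state w ≡ Free.iterate (carried w) duration baseState
        carried≤   : carried w ≤ t

    -- Seeing tokens resets the base to the current node, a drop resets it to the node just left,
    -- and any other step prolongs the free stretch.
    walk-covered : ∀ τ → Covered (walk τ)
    walk-covered zero = covered (here refl) initial 0 (λ _ → refl) refl ≤-refl
    walk-covered (suc τ) = step (walk-covered τ) (tokens-at origin (history w′) (origin ⊞ offset w′)) (dropped w) refl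
      where
      w = walk τ
      w′ = walk (suc τ)
      a = offset w
      s = state w
      c = carried w
      c′≤ : c ≤ t → carried w′ ≤ t
      c′≤ = ≤-trans (m∸n≤m c (dropped w))
      step : Covered w →
        count origin (history w′) (origin ⊞ offset w′) ≡ 0 ⊎
          (∃[ z ] z ∈ drops (history w′) × origin ⊞ z ≡ origin ⊞ offset w′) →
        ∀ r → dropped w ≡ r → Covered w′
      step (covered _ _ _ _ _ c≤t) (inj₂ (z , z∈ , eq)) _ _ =
        covered (there (T-all (suc τ) z∈)) (state w′) 0
          (λ v → trans (⊞⇒≈ origin (sym eq) v) (cong (v ⊞_) (sym (⊹-identityʳ z)))) refl (c′≤ c≤t)
      step (covered {x} base∈ s₀ j a≈ s≡ c≤t) (inj₁ none) zero r≡ =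
        covered base∈ s₀ (suc j)
          (λ v → trans (⊹-congʳ-≈ (pace s) a≈ v) (cong (v ⊞_) (trans (⊹-assoc x _ (pace s))
            (cong₂ (λ c s → x ⊹ (Free.displacement c j s₀ ⊹ pace s)) (sym c′≡c) s≡′))))
          (trans (cong (λ n → δ s (input (arrivalPort s) n (carried w′) false)) none)
            (cong (freeStep (carried w′)) s≡′))
          (c′≤ c≤t)
        where
        c′≡c : carried w′ ≡ c
        c′≡c = cong (c ∸_) r≡
        s≡′ : s ≡ Free.iterate (carried w′) j s₀
        s≡′ = trans s≡ (cong (λ c → Free.iterate c j s₀) (sym c′≡c))
      -- The new stretch starts at the node of the drop, already with the reduced supply, and the
      -- move away from it is its first step.
      step (covered _ _ _ _ _ c≤t) (inj₁ none) (suc r) r≡ =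
        covered (there (T-all (suc τ) (subst (λ r → a ∈ drops ((a , r) ∷ history w)) (sym r≡) (here refl)))) s 1
          (λ _ → refl) (cong (λ n → δ s (input (arrivalPort s) n (carried w′) false)) none) (c′≤ c≤t)

    walk-visitable : ∀ τ → ∃[ a ] a ∈ visitable T × a ≈ offset (walk τ)
    walk-visitable τ with covered {x} base∈ s₀ j a≈ _ c≤t ← walk-covered τ
      with j′ , j′< , j′≈ ← displacement-bounded (freeStep (carried (walk τ))) pace s₀ j
      = _ , ∈-cartesianProductWith⁺ _⊹_ base∈ 
              (∈-cartesianProductWith⁺ (λ (c , s) j → Free.displacement c j s)
                (∈-cartesianProduct⁺ (∈-upTo⁺ (s≤s c≤t)) (∈-allFin s₀)) (∈-upTo⁺ j′<))
          , λ v → trans (⊹-congˡ-≈ x j′≈ v) (sym (a≈ v))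

  -- The forbidden differences between chosen nodes.

  nearby : List Offset
  nearby = (0 , 0) ∷ unit north ∷ unit east ∷ unit south ∷ unit west ∷ []

  unit∈nearby : ∀ d → unit d ∈ nearby
  unit∈nearby north = there (here refl)
  unit∈nearby east  = there (there (here refl))
  unit∈nearby south = there (there (there (here refl)))
  unit∈nearby west  = there (there (there (there (here refl))))

  -- The differences to be avoided: the first two lists make one agent visit a drop of the other,
  -- in either order; the last makes the second node equal or adjacent to a visited one.
  footprint : List Offset → List Offset
  footprint T =
    cartesianProductWith (λ a z → a ⊹ M ⋆ z) (visitable T) T ++
    cartesianProductWith (λ a z → z ⊹ M ⋆ a) (visitable T) T ++
    cartesianProductWith _⊹_ (visitable T) nearby

  length-footprint : ∀ T → length T ≤ t →
    length (footprint T) ≤ suc t * (suc t * size * (size * suc N)) * (t + (t + 5))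
  length-footprint T short = begin
    length (footprint T)
      ≡⟨ trans (length-++ (cartesianProductWith _ V T)) (cong₂ _+_ (length-cartesianProductWith _ V T)
           (trans (length-++ (cartesianProductWith _ V T)) (cong₂ _+_ (length-cartesianProductWith _ V T)
             (length-cartesianProductWith _ V nearby)))) ⟩
    length V * length T + (length V * length T + length V * 5)
      ≡⟨ factor (length V) (length T) ⟩
    length V * (length T + (length T + 5))
      ≤⟨ *-mono-≤ (length-visitable T short) (+-mono-≤ short (+-monoˡ-≤ 5 short)) ⟩
    suc t * (suc t * size * (size * suc N)) * (t + (t + 5)) ∎
    where
    open ≤-Reasoning
    V = visitable T
    factor : ∀ v l → v * l + (v * l + v * 5) ≡ v * (l + (l + 5))
    factor = solve-∀

  module _ {T : List Offset} (T-all : AllDrops T) where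

    -- The coincidence is solved for `v` and for `u`, because `Spread` excludes a difference in one
    -- order only and the order of the two agents is arbitrary.
    visited-foreign-drop : ∀ τ u v {z} → z ∈ drops (history (walk τ)) →
      v ⊞ z ≡ u ⊞ offset (walk τ) →
      (∃[ β ] β ∈ footprint T × v ≡ u ⊞ β) × (∃[ β ] β ∈ footprint T × u ≡ v ⊞ β)
    visited-foreign-drop τ u v {z} z∈ eq =
      let a , a∈ , a≈ = walk-visitable T-all τ
          z∈T = T-all τ z∈
          eq′ = trans eq (sym (a≈ u))
      in (a ⊹ M ⋆ z ,
          ∈-++⁺ˡ (∈-cartesianProductWith⁺ (λ a z → a ⊹ M ⋆ z) a∈ z∈T) ,
          ⊞-solve {v} {u} {z} {a} eq′) ,
         (z ⊹ M ⋆ a ,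
          ∈-++⁺ʳ (cartesianProductWith _ (visitable T) T)
            (∈-++⁺ˡ (∈-cartesianProductWith⁺ (λ a z → z ⊹ M ⋆ a) a∈ z∈T)) ,
          ⊞-solve {u} {v} {a} {z} (sym eq′))

    visited-near : ∀ τ u {v e} → e ∈ nearby → v ≡ u ⊞ offset (walk τ) ⊞ e →
      ∃[ β ] β ∈ footprint T × v ≡ u ⊞ β
    visited-near τ u {v} {e} e∈ eq =
      let a , a∈ , a≈ = walk-visitable T-all τ
      in a ⊹ e ,
         ∈-++⁺ʳ (cartesianProductWith _ (visitable T) T)
           (∈-++⁺ʳ (cartesianProductWith _ (visitable T) T)
             (∈-cartesianProductWith⁺ _⊹_ a∈ e∈)) ,
         trans eq (trans (cong (_⊞ e) (sym (a≈ u))) (⊞-⊹ u a e))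

    visited-neighbour : ∀ τ u {v} d → v ≡ neighbour (u ⊞ offset (walk τ)) d →
      ∃[ β ] β ∈ footprint T × v ≡ u ⊞ β
    visited-neighbour τ u d eq = visited-near τ u (unit∈nearby d) (trans eq (neighbour≡⊞ _ d))

  -- The agents follow translated copies of the lone walk until the first mark.

  module Simulation
    (k : ℕ) (blackHole : Node) (place : Fin k → Node)
    (place-injective : Injective _≡_ _≡_ place)
    (no-foreign-tokens : ∀ τ {i j z} → j ≢ i → z ∈ drops (history (walk τ)) →
      place j ⊞ z ≢ place i ⊞ offset (walk τ))
    (no-visit : ∀ τ i → place i ⊞ offset (walk τ) ≢ blackHole)
    (no-approach : ∀ τ i d → blackHole ≢ neighbour (place i ⊞ offset (walk τ)) d)
    where

    open Execution A k t blackHole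
    open Agent
    open Config

    follower : ℕ → Fin k → Agent
    follower τ i = agent (place i ⊞ offset (walk τ)) (state (walk τ)) (carried (walk τ))

    record Follows (τ : ℕ) (c : Config) : Set where
      field
        agents≡  : ∀ i → agents c i ≡ just (follower τ i)
        tokens≡  : ∀ u → tokens c u ≡ sum (λ j → count (place j) (history (walk τ)) u)
        unmarked : ∀ l → marked c l ≡ false

    -- Marks are permanent, so one wrong mark excludes a solution for ever.
    Spoiled : Config → Set
    Spoiled c = ∃[ l ] marked c l ≡ true × (∀ d → l ≢ link blackHole d)

    spoiled-next : ∀ c → Spoiled c → Spoiled (Step.next c)
    spoiled-next c (l , marked-l , wrong) = l , cong (_∨ _) marked-l , wrong

    module _ (τ : ℕ) (c : Config) (follows : Follows τ c) where
      open Follows follows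
      open Step c hiding (dropped)

      w w′ : Walker
      w  = walk τ
      w′ = walk (suc τ)

      -- The marking agent is neither at the black hole nor next to it, so by `shared-link` its link
      -- is not incident to the black hole.
      spoiled-by-mark : Fin k → ∀ {d} → danger (φ (state w)) ≡ just d → Spoiled next
      spoiled-by-mark i {d} mark =
        l , trans (cong (marked c l ∨_) (dec-true (Fin.any? _) (i , marks-l))) (∨-zeroʳ _) , wrong
        where
        l : Link
        l = link (place i ⊞ offset w) d
        marks-l : (agents c i >>= marks) ≡ just l
        marks-l = trans (cong (_>>= marks) (agents≡ i)) (cong (Maybe.map (link (place i ⊞ offset w))) mark)
        wrong : ∀ e → l ≢ link blackHole e
        wrong e eq with shared-link d e eq
        ... | inj₁ b≡ = no-visit τ i (sym b≡)
        ... | inj₂ (d′ , b≡) = no-approach τ i d′ b≡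

      module _ (no-mark : danger (φ (state w)) ≡ nothing) where

        newMarked-false : ∀ l → newMarked l ≡ false
        newMarked-false l = cong₂ _∨_ (unmarked l) (dec-false (Fin.any? _) λ (i , eq) →
          contradiction
            (trans (sym eq) (trans (cong (_>>= marks) (agents≡ i))
              (cong (Maybe.map (link (place i ⊞ offset w))) no-mark)))
            λ ())

        destination≡ : ∀ x → destination x ≡ (position x ⊞ pace (state x) , arrivalPort (state x))
        destination≡ x with move (φ (state x))
        ... | nothing = cong (_, nothing) (sym (⊞-0 (position x)))
        ... | just d rewrite newMarked-false (link (position x) d) =
          cong (_, just (opposite d)) (neighbour≡⊞ (position x) d)

        survive≡ : ∀ {v d} → v ≢ blackHole → survive (v , d) ≡ just (v , d)
        survive≡ {v} {d} v≢ = cong (if_then nothing else just (v , d)) (dec-false (v ≟ⁿ blackHole) v≢)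

        arrivals≡ : ∀ i → arrivals i ≡ just (place i ⊞ offset w′ , arrivalPort (state w))
        arrivals≡ i = trans (cong (_>>= λ a → survive (destination a)) (agents≡ i))
          (trans (cong survive (trans (destination≡ (follower τ i))
                   (cong (_, arrivalPort (state w)) (⊞-⊹ (place i) (offset w) (pace (state w))))))
                 (survive≡ (no-visit (suc τ) i)))

        newTokens≡ : ∀ u → newTokens u ≡ sum (λ j → count (place j) (history w′) u)
        newTokens≡ u = begin
          tokens c u + Step.dropped c u
            ≡⟨ +-comm (tokens c u) _ ⟩
          Step.dropped c u + tokens c u
            ≡⟨ cong₂ _+_ (sum-cong-≗ (λ j → cong (releasedAt u) (agents≡ j))) (tokens≡ u) ⟩
          sum (λ j → releasedAt u (just (follower τ j))) + sum (λ j → count (place j) (history w) u)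
            -- What follower `j` releases at `u` is by definition the head term of
            -- `count (place j) (history w′) u`.
            ≡⟨ ∑-distrib-+ (λ j → releasedAt u (just (follower τ j))) _ ⟨
          sum (λ j → count (place j) (history w′) u) ∎
          where open ≡-Reasoning

        -- Without foreign tokens only the agent's own summand survives, and that one is invariant
        -- under translation.
        tokensSeen≡ : ∀ i → newTokens (place i ⊞ offset w′) ≡ count origin (history w′) (origin ⊞ offset w′)
        tokensSeen≡ i = trans (newTokens≡ _) (trans (sum-only _ i others)
          (count-translate (place i) origin (history w′) (offset w′)))
          where
          others : ∀ j → j ≢ i → count (place j) (history w′) (place i ⊞ offset w′) ≡ 0
          others j j≢i with tokens-at (place j) (history w′) (place i ⊞ offset w′)
          ... | inj₁ none = none
          ... | inj₂ (z , z∈ , eq) = contradiction eq (no-foreign-tokens (suc τ) j≢i z∈)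

        otherAgentAt≡ : ∀ i → otherAgentAt i (place i ⊞ offset w′) ≡ false
        otherAgentAt≡ i = dec-false
          (Fin.any? λ j →
            ¬? (j Fin.≟ i) ×-dec Maybe.≡-dec _≟ⁿ_ (newPosition j) (just (place i ⊞ offset w′)))
          λ (j , j≢i , eq) → j≢i (place-injective (⊞-injective (offset w′) (Maybe.just-injective
            (trans (sym (cong (Maybe.map proj₁) (arrivals≡ j))) eq))))

        newAgent≡ : ∀ i → newAgent i ≡ just (follower (suc τ) i)
        newAgent≡ i = trans (cong (_>>= act) (agents≡ i)) (trans (cong (_>>= react (follower τ i)) (arrivals≡ i))
          (cong₂ (λ n b → just (agent (place i ⊞ offset w′)
                   (δ (state w) (input (arrivalPort (state w)) n (carried w′) b)) (carried w′)))
            (tokensSeen≡ i) (otherAgentAt≡ i)))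
          where
          react : Agent → Node × Maybe Direction → Maybe Agent
          react a (v , d) = just (agent v (δ (state a) (input d (newTokens v) y (otherAgentAt i v))) y)
            where y = carried a ∸ releasedBy a
          act : Agent → Maybe Agent
          act a = arrivals i >>= react a

        follows-next : Follows (suc τ) next
        follows-next = record { agents≡ = newAgent≡ ; tokens≡ = newTokens≡ ; unmarked = newMarked-false }

    follows-or-spoiled : Fin k → ∀ τ → Follows τ (run place τ) ⊎ Spoiled (run place τ)
    follows-or-spoiled i zero = inj₁ (record
      { agents≡  = λ j → cong (λ v → just (agent v initial t)) (sym (⊞-0 (place j)))
      ; tokens≡  = λ u → sym (sum-replicate-zero k)
      ; unmarked = λ _ → refl })
    follows-or-spoiled i (suc τ) with follows-or-spoiled i τ
    ... | inj₂ spoiled = inj₂ (spoiled-next (run place τ) spoiled)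
    ... | inj₁ follows = step (danger (φ (state (walk τ)))) refl
      where
      step : ∀ m → danger (φ (state (walk τ))) ≡ m →
        Follows (suc τ) (run place (suc τ)) ⊎ Spoiled (run place (suc τ))
      step (just d) mark    = inj₂ (spoiled-by-mark τ (run place τ) follows i mark)
      step nothing  no-mark = inj₁ (follows-next τ (run place τ) follows no-mark)

    never-solved : ∀ τ → ¬ Solved (run place τ)
    never-solved τ (links , i , _) with follows-or-spoiled i τ
    ... | inj₁ follows = contradiction
      (trans (sym (Follows.unmarked follows (link blackHole north)))
             (Equivalence.from (links (link blackHole north)) (north , refl)))
      λ ()
    ... | inj₂ (l , marked-l , wrong) with d , l≡ ← Equivalence.to (links l) marked-l = wrong d l≡

  -- Spread nodes satisfy the assumptions of the simulation.

  module SpreadStart {T : List Offset} (T-all : AllDrops T) (k : ℕ) (p : Fin (suc k) → Node)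
    (p-spread : Spread (footprint T) (suc k) p)
    where

    -- Index `zero` precedes all agents, so `Spread` excludes exactly the differences from an
    -- agent's start to the black hole.
    blackHole : Node
    blackHole = p zero

    place : Fin k → Node
    place i = p (suc i)

    Near : Fin (suc k) → Fin (suc k) → Set
    Near i j = ∃[ β ] β ∈ footprint T × p i ≡ p j ⊞ β

    apart : ∀ {i j} → i Fin.< j → ¬ Near i j
    apart i<j (β , β∈ , eq) = p-spread i<j β∈ eq

    -- For distinct indices, one of the two relations is in the order excluded by `Spread`.
    near-near⇒≡ : ∀ {i j} → Near i j → Near j i → i ≡ j
    near-near⇒≡ {i} {j} i-near-j j-near-i with Fin.<-cmp i j
    ... | tri< i<j _ _ = contradiction i-near-j (apart i<j)
    ... | tri≈ _ i≡j _ = i≡j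
    ... | tri> _ _ j<i = contradiction j-near-i (apart j<i)

    p-injective : Injective _≡_ _≡_ p
    p-injective eq = near-near⇒≡ (near eq) (near (sym eq))
      where
      near : ∀ {i j} → p i ≡ p j → Near i j
      -- At time 0 the walk is at its start and `(0 , 0)` is in `nearby`, so equal nodes count as
      -- near.
      near {i} {j} eq = visited-near T-all 0 (p j) (here refl)
        (trans eq (sym (trans (⊞-0 _) (⊞-0 (p j)))))

    place-injective : Injective _≡_ _≡_ place
    place-injective eq = Fin.suc-injective (p-injective eq)

    place≢blackHole : ∀ i → place i ≢ blackHole
    place≢blackHole i eq = Fin.0≢1+n (p-injective (sym eq))

    no-foreign-tokens : ∀ τ {i j z} → j ≢ i → z ∈ drops (history (walk τ)) →
      place j ⊞ z ≢ place i ⊞ offset (walk τ)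
    no-foreign-tokens τ {i} {j} j≢i z∈ eq =
      let j-near-i , i-near-j = visited-foreign-drop T-all τ (place i) (place j) z∈ eq
      in j≢i (Fin.suc-injective (near-near⇒≡ j-near-i i-near-j))

    no-visit : ∀ τ i → place i ⊞ offset (walk τ) ≢ blackHole
    no-visit τ i eq = apart (s≤s z≤n) 
      (visited-near T-all τ (place i) (here refl) (trans (sym eq) (sym (⊞-0 _))))

    no-approach : ∀ τ i d → blackHole ≢ neighbour (place i ⊞ offset (walk τ)) d
    no-approach τ i d eq = apart (s≤s z≤n) (visited-neighbour T-all τ (place i) d eq)

    open Simulation k blackHole place place-injective no-foreign-tokens no-visit no-approach public

-- Choice of the torus size and contradiction.

theorem3p1 : ∀ (k t : ℕ) → 2 ≤ k → ¬ (∃[ A ] SolvesBHS k t A)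
-- The goal is a falsehood, so the doubly negated existence of `T` may be used as if `T` were given.
theorem3p1 k t _ (A , solves) = finitely-many-drops λ (T , short , T-all) →
  let p , p-spread = spread-∃ (footprint T) k (room T short)
      module S = SpreadStart T-all k p p-spread
      τ , solved = solves N N (s≤s (s≤s (s≤s z≤n))) (s≤s (s≤s (s≤s z≤n)))
        S.blackHole S.place S.place-injective S.place≢blackHole
  in S.never-solved τ solved
  where
  size C : ℕ
  size = Automaton.size A
  -- The bound on `k * length (footprint T)` is `C * suc N`, with `C` free of `N`. For `N = C + 3`
  -- the square `N * N` exceeds it by `2 * C + 9`, and `N` is at least 3.
  C = k * (suc t * (suc t * size * size) * (t + (t + 5)))
  open Solo A t (suc (suc C))
  open Shift (suc (suc C))

  room : ∀ T → length T ≤ t → k * length (footprint T) < N * N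
  room T short = begin-strict
    k * length (footprint T)                                          ≤⟨ *-monoʳ-≤ k (length-footprint T short) ⟩
    k * (suc t * (suc t * size * (size * suc N)) * (t + (t + 5)))     ≡⟨ pull k (suc t) size (suc N) (t + (t + 5)) ⟩
    C * suc N                                                         <⟨ m<m+n _ (s≤s z≤n) ⟩
    C * suc N + suc (2 * C + 8)                                       ≡⟨ square C ⟩
    N * N                                                             ∎
    where
    open ≤-Reasoning
    pull : ∀ k u s n r → k * (u * (u * s * (s * n)) * r) ≡ k * (u * (u * s * s) * r) * n
    pull = solve-∀
    square : ∀ c → c * suc (suc (suc (suc c))) + suc (2 * c + 8) ≡ suc (suc (suc c)) * suc (suc (suc c))
    square = solve-∀
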